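{- Let $\Phi=(G,\varphi)$ be a complex unit gain graph of order $n$. Then $$r(G)-2\theta(G)\leq r(\Phi)\leq r(G)+2\theta(G).$$
   Context: A complex unit gain graph ($\mathbb{T}$-gain graph) $\Phi=(G,\varphi)$ consists of a finite simple graph $G$ (the underlying graph) with vertex set $\{v_1,\dots,v_n\}$ and a gain function $\varphi$ assigning to each oriented edge $e_{ij}$ (from $v_i$ to $v_j$, where $v_iv_j\in E(G)$) a complex number $\varphi(e_{ij})$ of modulus $1$, with $\varphi(e_{ji})=\varphi(e_{ij})^{ -1}=\overline{\varphi(e_{ij})}$. The adjacency matrix $A(\Phi)$ is the $n\times n$ Hermitian matrix whose $(i,j)$ entry is $\varphi(e_{ij})$ if $v_iv_j\in E(G)$ and $0$ otherwise; $r(\Phi)$ denotes the rank of $A(\Phi)$. $r(G)$ denotes the rank of the ($0$-$1$) adjacency matrix of $G$. $\theta(G)=|E(G)|-|V(G)|+\omega(G)$ is the dimension of the cycle space of $G$, where $\omega(G)$ is the number of connected components of $G$. -}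

module Defs where

open import Algebra.Bundles.Raw using (RawMonoid)
open import Algebra.Definitions.RawMonoid using (sum)
open import Data.Bool using (Bool; T)
open import Data.Bool.Properties using (T?)
open import Data.Empty using (⊥-elim)
open import Data.Fin using (Fin; punchIn; punchOut)
import Data.Fin as Fin
import Data.Fin.Properties as Fin
open import Data.Integer using (ℤ; +_)
import Data.Integer as ℤ
open import Data.List using (List; []; _∷_; length; filter; cartesianProduct; allFin)
open import Data.List.Membership.Propositional using (_∈_)
open import Data.List.Membership.Propositional.Properties using (∈-filter⁺; ∈-filter⁻; ∈-cartesianProduct⁺; ∈-allFin)
open import Data.List.Relation.Unary.Any using (here; there)
open import Data.Nat using (ℕ; zero; suc)
import Data.Nat as ℕ
import Data.Nat.Properties as ℕ
open import Data.Product using (Σ; ∃; _×_; _,_; proj₁; proj₂)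
open import Data.Rational using (ℚ; 0ℚ; 1ℚ; ½)
import Data.Rational as ℚ
import Data.Rational.Properties as ℚ
open import Data.Rational.Solver using (module +-*-Solver)
open import Function using (_∘_; id)
open import Function.Definitions using (Injective; StrictlySurjective)
open import Level using (0ℓ)
open import Relation.Binary using (Rel; tri<; tri≈; tri>)
open import Relation.Binary.Construct.Closure.Equivalence using (EqClosure)
import Relation.Binary.Construct.Closure.Equivalence as Eq
open import Relation.Binary.Construct.Closure.ReflexiveTransitive using (Star; ε; _◅_; _◅◅_)
import Relation.Binary.Construct.Closure.ReflexiveTransitive as Star
open import Relation.Binary.Construct.Closure.Symmetric using (fwd; bwd)
open import Relation.Binary.PropositionalEquality
open import Relation.Nullary using (¬_; Dec; yes; no; contradiction; _×-dec_)

------------------------------------------------------------------------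
-- Real numbers: Cauchy sequences of rationals, equality being convergence
-- of the difference to 0.

IsCauchy : (ℕ → ℚ) → Set
IsCauchy x = ∀ δ → 0ℚ ℚ.< δ →
  ∃ λ N → ∀ m n → N ℕ.≤ m → N ℕ.≤ n → ℚ.∣ x m ℚ.- x n ∣ ℚ.< δ

record ℝ : Set where
  constructor mkℝ
  field
    seq    : ℕ → ℚ
    cauchy : IsCauchy seq
open ℝ public

infix 4 _≈ℝ_

record _≈ℝ_ (x y : ℝ) : Set where
  constructor mk≈ℝ
  field
    close : ∀ δ → 0ℚ ℚ.< δ →
      ∃ λ N → ∀ n → N ℕ.≤ n → ℚ.∣ seq x n ℚ.- seq y n ∣ ℚ.< δ
open _≈ℝ_ public

fromℚ : ℚ → ℝ
fromℚ q = mkℝ (λ _ → q) λ δ 0<δ → 0 , λ _ _ _ _ →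
  subst (ℚ._< δ) (sym (cong ℚ.∣_∣ (ℚ.+-inverseʳ q))) 0<δ

open +-*-Solver using (solve; _:+_; _:*_; _:-_; :-_; _:=_)

abstract
  private
    half-sum : ∀ δ → ½ ℚ.* δ ℚ.+ ½ ℚ.* δ ≡ δ
    half-sum δ = trans (sym (ℚ.*-distribʳ-+ δ ½ ½)) (ℚ.*-identityˡ δ)

    half-pos : ∀ δ → 0ℚ ℚ.< δ → 0ℚ ℚ.< ½ ℚ.* δ
    half-pos δ 0<δ = subst (ℚ._< ½ ℚ.* δ) (ℚ.*-zeroʳ ½) (ℚ.*-monoʳ-<-pos ½ 0<δ)

    +-cauchy : ∀ x y → IsCauchy x → IsCauchy y → IsCauchy (λ n → x n ℚ.+ y n)
    +-cauchy x y cx cy δ 0<δ with cx (½ ℚ.* δ) (half-pos δ 0<δ) | cy (½ ℚ.* δ) (half-pos δ 0<δ)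
    ... | M , hx | N , hy = M ℕ.⊔ N , λ m n p q → begin-strict
      ℚ.∣ (x m ℚ.+ y m) ℚ.- (x n ℚ.+ y n) ∣
        ≡⟨ cong ℚ.∣_∣ (solve 4 (λ a b c d → (a :+ b) :- (c :+ d) := (a :- c) :+ (b :- d)) refl (x m) (y m) (x n) (y n)) ⟩
      ℚ.∣ (x m ℚ.- x n) ℚ.+ (y m ℚ.- y n) ∣
        ≤⟨ ℚ.∣p+q∣≤∣p∣+∣q∣ (x m ℚ.- x n) (y m ℚ.- y n) ⟩
      ℚ.∣ x m ℚ.- x n ∣ ℚ.+ ℚ.∣ y m ℚ.- y n ∣
        <⟨ ℚ.+-mono-< (hx m n (ℕ.m⊔n≤o⇒m≤o M N p) (ℕ.m⊔n≤o⇒m≤o M N q))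
                      (hy m n (ℕ.m⊔n≤o⇒n≤o M N p) (ℕ.m⊔n≤o⇒n≤o M N q)) ⟩
      ½ ℚ.* δ ℚ.+ ½ ℚ.* δ
        ≡⟨ half-sum δ ⟩
      δ ∎
      where open ℚ.≤-Reasoning

    neg-cauchy : ∀ x → IsCauchy x → IsCauchy (λ n → ℚ.- x n)
    neg-cauchy x cx δ 0<δ with cx δ 0<δ
    ... | N , h = N , λ m n p q → subst (ℚ._< δ)
      (trans (sym (ℚ.∣-p∣≡∣p∣ (x m ℚ.- x n)))
             (cong ℚ.∣_∣ (solve 2 (λ a b → :- (a :- b) := (:- a) :- (:- b)) refl (x m) (x n))))
      (h m n p q)

    eventually-bounded : ∀ x → IsCauchy x →
      ∃ λ B → ℚ.Positive B × ∃ λ N → ∀ n → N ℕ.≤ n → ℚ.∣ x n ∣ ℚ.≤ B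
    eventually-bounded x cx with cx 1ℚ (ℚ.positive⁻¹ 1ℚ)
    ... | N , h = 1ℚ ℚ.+ ℚ.∣ x N ∣ ,
      ℚ.positive (ℚ.+-mono-<-≤ (ℚ.positive⁻¹ 1ℚ) (ℚ.0≤∣p∣ (x N))) ,
      N , λ n p → begin
      ℚ.∣ x n ∣
        ≡⟨ cong ℚ.∣_∣ (solve 2 (λ a b → a := (a :- b) :+ b) refl (x n) (x N)) ⟩
      ℚ.∣ (x n ℚ.- x N) ℚ.+ x N ∣
        ≤⟨ ℚ.∣p+q∣≤∣p∣+∣q∣ (x n ℚ.- x N) (x N) ⟩
      ℚ.∣ x n ℚ.- x N ∣ ℚ.+ ℚ.∣ x N ∣
        ≤⟨ ℚ.+-monoˡ-≤ ℚ.∣ x N ∣ (ℚ.<⇒≤ (h n N p ℕ.≤-refl)) ⟩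
      1ℚ ℚ.+ ℚ.∣ x N ∣ ∎
      where open ℚ.≤-Reasoning

    *-bound : ∀ B .{{_ : ℚ.Positive B}} p q δ →
              ℚ.∣ p ∣ ℚ.≤ B → ℚ.∣ q ∣ ℚ.< δ → ℚ.∣ p ℚ.* q ∣ ℚ.< B ℚ.* δ
    *-bound B p q δ p≤B q<δ = begin-strict
      ℚ.∣ p ℚ.* q ∣          ≡⟨ ℚ.∣p*q∣≡∣p∣*∣q∣ p q ⟩
      ℚ.∣ p ∣ ℚ.* ℚ.∣ q ∣    ≤⟨ ℚ.*-monoʳ-≤-nonNeg ℚ.∣ q ∣ {{ℚ.∣-∣-nonNeg q}} p≤B ⟩
      B ℚ.* ℚ.∣ q ∣          <⟨ ℚ.*-monoʳ-<-pos B q<δ ⟩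
      B ℚ.* δ ∎
      where open ℚ.≤-Reasoning

    *-diff : ∀ a b c d → a ℚ.* b ℚ.- c ℚ.* d ≡ a ℚ.* (b ℚ.- d) ℚ.+ d ℚ.* (a ℚ.- c)
    *-diff = solve 4 (λ a b c d → a :* b :- c :* d := a :* (b :- d) :+ d :* (a :- c)) refl

    scale : ∀ D δ → ℚ.Positive D → 0ℚ ℚ.< δ → ∃ λ η → 0ℚ ℚ.< η × D ℚ.* η ≡ δ
    scale D δ D>0 0<δ = η ,
      subst (ℚ._< η) (ℚ.*-zeroʳ (ℚ.1/ D)) (ℚ.*-monoʳ-<-pos (ℚ.1/ D) {{ℚ.1/pos⇒pos D}} 0<δ) ,
      trans (sym (ℚ.*-assoc D (ℚ.1/ D) δ))
            (trans (cong (ℚ._* δ) (ℚ.*-inverseʳ D)) (ℚ.*-identityˡ δ))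
      where
      instance
        D⁺ : ℚ.Positive D
        D⁺ = D>0
        D≢0 : ℚ.NonZero D
        D≢0 = ℚ.pos⇒nonZero D
      η : ℚ
      η = ℚ.1/ D ℚ.* δ

    *-estimate : ∀ B C .{{_ : ℚ.Positive B}} .{{_ : ℚ.Positive C}} η a b c d →
                 ℚ.∣ a ∣ ℚ.≤ B → ℚ.∣ d ∣ ℚ.≤ C →
                 ℚ.∣ b ℚ.- d ∣ ℚ.< η → ℚ.∣ a ℚ.- c ∣ ℚ.< η →
                 ℚ.∣ a ℚ.* b ℚ.- c ℚ.* d ∣ ℚ.< (B ℚ.+ C) ℚ.* η
    *-estimate B C η a b c d a≤B d≤C b-d a-c = begin-strict
      ℚ.∣ a ℚ.* b ℚ.- c ℚ.* d ∣
        ≡⟨ cong ℚ.∣_∣ (*-diff a b c d) ⟩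
      ℚ.∣ a ℚ.* (b ℚ.- d) ℚ.+ d ℚ.* (a ℚ.- c) ∣
        ≤⟨ ℚ.∣p+q∣≤∣p∣+∣q∣ (a ℚ.* (b ℚ.- d)) (d ℚ.* (a ℚ.- c)) ⟩
      ℚ.∣ a ℚ.* (b ℚ.- d) ∣ ℚ.+ ℚ.∣ d ℚ.* (a ℚ.- c) ∣
        <⟨ ℚ.+-mono-< (*-bound B a (b ℚ.- d) η a≤B b-d) (*-bound C d (a ℚ.- c) η d≤C a-c) ⟩
      B ℚ.* η ℚ.+ C ℚ.* η
        ≡⟨ ℚ.*-distribʳ-+ η B C ⟨
      (B ℚ.+ C) ℚ.* η ∎
      where open ℚ.≤-Reasoning

    *-cauchy : ∀ x y → IsCauchy x → IsCauchy y → IsCauchy (λ n → x n ℚ.* y n)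
    *-cauchy x y cx cy δ 0<δ =
      let B , B>0 , K , bx = eventually-bounded x cx
          C , C>0 , L , by = eventually-bounded y cy
          η , 0<η , D*η≡δ  = scale (B ℚ.+ C) δ (ℚ.pos+pos⇒pos B {{B>0}} C {{C>0}}) 0<δ
          M , hx           = cx η 0<η
          N , hy           = cy η 0<η
      in combine B B>0 K bx C C>0 L by η D*η≡δ M hx N hy
      where
      combine : ∀ B → ℚ.Positive B → ∀ K → (∀ n → K ℕ.≤ n → ℚ.∣ x n ∣ ℚ.≤ B) →
                ∀ C → ℚ.Positive C → ∀ L → (∀ n → L ℕ.≤ n → ℚ.∣ y n ∣ ℚ.≤ C) →
                ∀ η → (B ℚ.+ C) ℚ.* η ≡ δ →
                ∀ M → (∀ m n → M ℕ.≤ m → M ℕ.≤ n → ℚ.∣ x m ℚ.- x n ∣ ℚ.< η) →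
                ∀ N → (∀ m n → N ℕ.≤ m → N ℕ.≤ n → ℚ.∣ y m ℚ.- y n ∣ ℚ.< η) →
                ∃ λ N → ∀ m n → N ℕ.≤ m → N ℕ.≤ n → ℚ.∣ x m ℚ.* y m ℚ.- x n ℚ.* y n ∣ ℚ.< δ
      combine B B>0 K bx C C>0 L by η D*η≡δ M hx N hy =
        (K ℕ.⊔ L) ℕ.⊔ (M ℕ.⊔ N) , λ m n p q →
        subst (ℚ.∣ x m ℚ.* y m ℚ.- x n ℚ.* y n ∣ ℚ.<_) D*η≡δ
          (*-estimate B C {{B>0}} {{C>0}} η (x m) (y m) (x n) (y n)
            (bx m (ℕ.m⊔n≤o⇒m≤o K L (left p))) (by n (ℕ.m⊔n≤o⇒n≤o K L (left q)))
            (hy m n (ℕ.m⊔n≤o⇒n≤o M N (right p)) (ℕ.m⊔n≤o⇒n≤o M N (right q)))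
            (hx m n (ℕ.m⊔n≤o⇒m≤o M N (right p)) (ℕ.m⊔n≤o⇒m≤o M N (right q))))
        where
        left : ∀ {m} → (K ℕ.⊔ L) ℕ.⊔ (M ℕ.⊔ N) ℕ.≤ m → K ℕ.⊔ L ℕ.≤ m
        left = ℕ.m⊔n≤o⇒m≤o (K ℕ.⊔ L) (M ℕ.⊔ N)
        right : ∀ {m} → (K ℕ.⊔ L) ℕ.⊔ (M ℕ.⊔ N) ℕ.≤ m → M ℕ.⊔ N ℕ.≤ m
        right = ℕ.m⊔n≤o⇒n≤o (K ℕ.⊔ L) (M ℕ.⊔ N)

infixl 6 _+ℝ_ _-ℝ_
infixl 7 _*ℝ_
infix  8 -ℝ_

0ℝ 1ℝ : ℝ
0ℝ = fromℚ 0ℚ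
1ℝ = fromℚ 1ℚ

_+ℝ_ _*ℝ_ : ℝ → ℝ → ℝ
x +ℝ y = mkℝ (λ n → seq x n ℚ.+ seq y n) (+-cauchy (seq x) (seq y) (cauchy x) (cauchy y))
x *ℝ y = mkℝ (λ n → seq x n ℚ.* seq y n) (*-cauchy (seq x) (seq y) (cauchy x) (cauchy y))

-ℝ_ : ℝ → ℝ
-ℝ x = mkℝ (λ n → ℚ.- seq x n) (neg-cauchy (seq x) (cauchy x))

_-ℝ_ : ℝ → ℝ → ℝ
x -ℝ y = x +ℝ (-ℝ y)

------------------------------------------------------------------------
-- Complex numbers

record ℂ : Set where
  constructor _+i_
  field
    re im : ℝ
open ℂ public

infix 4 _≈_

record _≈_ (z w : ℂ) : Set where
  constructor mk≈
  field
    re≈ : re z ≈ℝ re w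
    im≈ : im z ≈ℝ im w
open _≈_ public

infixl 6 _+_
infixl 7 _*_

0ℂ 1ℂ : ℂ
0ℂ = 0ℝ +i 0ℝ
1ℂ = 1ℝ +i 0ℝ

_+_ _*_ : ℂ → ℂ → ℂ
z + w = (re z +ℝ re w) +i (im z +ℝ im w)
z * w = (re z *ℝ re w -ℝ im z *ℝ im w) +i (re z *ℝ im w +ℝ im z *ℝ re w)

conj : ℂ → ℂ
conj z = re z +i (-ℝ im z)

∣_∣² : ℂ → ℝ
∣ z ∣² = re z *ℝ re z +ℝ im z *ℝ im z

+-rawMonoid : RawMonoid 0ℓ 0ℓ
+-rawMonoid = record { Carrier = ℂ ; _≈_ = _≈_ ; _∙_ = _+_ ; ε = 0ℂ }

∑ : ∀ {k} → (Fin k → ℂ) → ℂ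
∑ = sum +-rawMonoid

------------------------------------------------------------------------
-- Rank of a complex matrix: the largest number of linearly independent
-- columns.

Matrix : ℕ → ℕ → Set
Matrix m n = Fin m → Fin n → ℂ

LinearlyIndependent : ∀ {m k} → (Fin k → Fin m → ℂ) → Set
LinearlyIndependent {m} {k} v =
  (c : Fin k → ℂ) → (∀ i → ∑ (λ j → c j * v j i) ≈ 0ℂ) → ∀ j → c j ≈ 0ℂ

HasIndependentColumns : ∀ {m n} → Matrix m n → ℕ → Set
HasIndependentColumns {m} {n} A k = Σ (Fin k → Fin n) λ s →
  Injective _≡_ _≡_ s × LinearlyIndependent (λ j i → A i (s j))

-- The rank is a relation, since equality of real numbers is undecidable and
-- the rank cannot be computed from the entries.  It is single-valued
-- (IsRank-unique) and classically total (IsRank-exists).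
record IsRank {m n} (A : Matrix m n) (r : ℕ) : Set where
  field
    attained : HasIndependentColumns A r
    maximal  : ∀ k → HasIndependentColumns A k → k ℕ.≤ r
open IsRank public

IsRank-unique : ∀ {m n} {A : Matrix m n} {r s} → IsRank A r → IsRank A s → r ≡ s
IsRank-unique p q = ℕ.≤-antisym (maximal q _ (attained p)) (maximal p _ (attained q))

IsRank-exists : ∀ {m n} (A : Matrix m n) → ¬ ¬ ∃ (IsRank A)
IsRank-exists {m} {n} A none =
  climb (suc n) λ (k , n<k , s , inj , _) → ℕ.<⇒≱ n<k (Fin.injective⇒≤ inj)
  where
  climb : ∀ b → ¬ ¬ ∃ λ k → b ℕ.≤ k × HasIndependentColumns A k
  climb zero    h = h (0 , ℕ.z≤n , (λ ()) , (λ {}) , λ _ _ ())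
  climb (suc b) h = climb b λ (k , b≤k , ind) → none (k , record
    { attained = ind
    ; maximal  = λ l ind′ → ℕ.≮⇒≥ λ k<l → h (l , ℕ.≤-trans (ℕ.s≤s b≤k) k<l , ind′)
    })

------------------------------------------------------------------------
-- Finite simple graphs

record Graph (n : ℕ) : Set where
  field
    adj        : Fin n → Fin n → Bool
    adj-sym    : ∀ i j → T (adj i j) → T (adj j i)
    adj-irrefl : ∀ i → ¬ T (adj i i)

  Adj : Rel (Fin n) 0ℓ
  Adj i j = T (adj i j)

  adj? : ∀ i j → Dec (Adj i j)
  adj? i j = T? (adj i j)

  -- Each edge is listed once, with its smaller endpoint first.
  edges : List (Fin n × Fin n)
  edges = filter (λ (i , j) → (i Fin.<? j) ×-dec adj? i j)
                 (cartesianProduct (allFin n) (allFin n))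

  ∣E∣ : ℕ
  ∣E∣ = length edges

  Connected : Rel (Fin n) 0ℓ
  Connected = Star Adj

-- A bijection between the classes of R and Fin c.
record Classes {n} (R : Rel (Fin n) 0ℓ) (c : ℕ) : Set where
  field
    class    : Fin n → Fin c
    onto     : StrictlySurjective _≡_ class
    sound    : ∀ {i j} → class i ≡ class j → R i j
    complete : ∀ {i j} → R i j → class i ≡ class j

private
  Listed : ∀ {n} → List (Fin n × Fin n) → Rel (Fin n) 0ℓ
  Listed es i j = (i , j) ∈ es

  fold-class : ∀ {n c} {R : Rel (Fin n) 0ℓ} (f : Fin n → Fin c) →
               (∀ {i j} → R i j → f i ≡ f j) →
               ∀ {i j} → EqClosure R i j → f i ≡ f j
  fold-class f h = Eq.gfold isEquivalence f h

  linkedClasses : ∀ {n} (es : List (Fin n × Fin n)) → ∃ (Classes (EqClosure (Listed es)))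
  linkedClasses {n} [] = n , record
    { class    = id
    ; onto     = λ k → k , refl
    ; sound    = λ { refl → ε }
    ; complete = fold-class id λ ()
    }
  linkedClasses {n} ((a , b) ∷ es) with linkedClasses es
  ... | zero , C = ⊥-elim (Fin.¬Fin0 (Classes.class C a))
  ... | suc c , C = extend
    where
    open Classes C renaming (class to l)

    old : ∀ {i j} → l i ≡ l j → EqClosure (Listed ((a , b) ∷ es)) i j
    old eq = Eq.map there (sound eq)

    new : EqClosure (Listed ((a , b) ∷ es)) a b
    new = fwd (here refl) ◅ ε

    extend : ∃ (Classes (EqClosure (Listed ((a , b) ∷ es))))
    extend with l a Fin.≟ l b
    ... | yes la≡lb = suc c , record
      { class    = l
      ; onto     = onto
      ; sound    = old
      ; complete = fold-class l λ { (here refl) → la≡lb ; (there e) → complete (fwd e ◅ ε) }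
      }
    ... | no la≢lb = c , record
      { class    = merged
      ; onto     = merged-onto
      ; sound    = λ {i} {j} eq → merged-sound (Fin.punchOut-injective (avoids i) (avoids j) eq)
      ; complete = fold-class merged λ
          { (here refl) → merged-cong (trans (redirect-other a la≢lb) (sym (redirect-b b refl)))
          ; {i} {j} (there e) → merged-cong (redirect-cong i j (complete (fwd e ◅ ε)))
          }
      }
      where
      redirect : Fin n → Fin (suc c)
      redirect i with l i Fin.≟ l b
      ... | yes _ = l a
      ... | no  _ = l i

      redirect-b : ∀ i → l i ≡ l b → redirect i ≡ l a
      redirect-b i eq with l i Fin.≟ l b
      ... | yes _  = refl
      ... | no neq = contradiction eq neq

      redirect-other : ∀ i → l i ≢ l b → redirect i ≡ l i
      redirect-other i neq with l i Fin.≟ l b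
      ... | yes eq = contradiction eq neq
      ... | no _   = refl

      redirect-cong : ∀ i j → l i ≡ l j → redirect i ≡ redirect j
      redirect-cong i j eq with l i Fin.≟ l b
      ... | yes p = sym (redirect-b j (trans (sym eq) p))
      ... | no ¬p = trans eq (sym (redirect-other j (¬p ∘ trans eq)))

      avoids : ∀ i → l b ≢ redirect i
      avoids i with l i Fin.≟ l b
      ... | yes _  = la≢lb ∘ sym
      ... | no neq = neq ∘ sym

      merged : Fin n → Fin c
      merged i = punchOut (avoids i)

      merged-cong : ∀ {i j} → redirect i ≡ redirect j → merged i ≡ merged j
      merged-cong = Fin.punchOut-cong (l b)

      merged-onto : StrictlySurjective _≡_ merged
      merged-onto k with onto (punchIn (l b) k)
      ... | i , li≡ = i , trans (Fin.punchOut-cong (l b) (trans (redirect-other i li≢lb) li≡))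
                                (Fin.punchOut-punchIn (l b))
        where
        li≢lb : l i ≢ l b
        li≢lb eq = Fin.punchInᵢ≢i (l b) k (trans (sym li≡) eq)

      to-redirect : ∀ i → ∃ λ k → l k ≡ redirect i × EqClosure (Listed ((a , b) ∷ es)) i k
      to-redirect i with l i Fin.≟ l b
      ... | yes p = a , refl , old p ◅◅ Eq.symmetric _ new
      ... | no _  = i , refl , ε

      merged-sound : ∀ {i j} → redirect i ≡ redirect j → EqClosure (Listed ((a , b) ∷ es)) i j
      merged-sound {i} {j} eq with to-redirect i | to-redirect j
      ... | k , lk , i~k | m , lm , j~m =
        i~k ◅◅ old (trans lk (trans eq (sym lm))) ◅◅ Eq.symmetric _ j~m

module _ {n} (G : Graph n) where
  open Graph G

  private
    edges-sound : ∀ {i j} → (i , j) ∈ edges → Adj i j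
    edges-sound e = proj₂ (proj₂ (∈-filter⁻ (λ (i , j) → (i Fin.<? j) ×-dec adj? i j)
                                            {xs = cartesianProduct (allFin n) (allFin n)} e))

    edges-complete : ∀ {i j} → i Fin.< j → Adj i j → (i , j) ∈ edges
    edges-complete {i} {j} i<j e =
      ∈-filter⁺ (λ (i , j) → (i Fin.<? j) ×-dec adj? i j)
                (∈-cartesianProduct⁺ (∈-allFin i) (∈-allFin j)) (i<j , e)

    toStar : ∀ {i j} → EqClosure (Listed edges) i j → Connected i j
    toStar = Star.map λ { (fwd e) → edges-sound e ; (bwd e) → adj-sym _ _ (edges-sound e) }

    fromStar : ∀ {i j} → Connected i j → EqClosure (Listed edges) i j
    fromStar = Star.map step
      where
      step : ∀ {i j} → Adj i j → _
      step {i} {j} e with Fin.<-cmp i j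
      ... | tri< i<j _ _  = fwd (edges-complete i<j e)
      ... | tri≈ _ refl _ = contradiction e (adj-irrefl i)
      ... | tri> _ _ j<i  = bwd (edges-complete j<i (adj-sym _ _ e))

  components : ∃ (Classes Connected)
  components with linkedClasses edges
  ... | c , C = c , record
    { class    = class
    ; onto     = onto
    ; sound    = toStar ∘ sound
    ; complete = complete ∘ fromStar
    }
    where open Classes C

  ω : ℕ
  ω = proj₁ components

  θ : ℤ
  θ = + ∣E∣ ℤ.- + n ℤ.+ + ω

------------------------------------------------------------------------
-- Complex unit gain graphs

-- φ e is the gain of the oriented edge from i to j, where e : Adj i j.
-- Modulus 1 is expressed by ∣ φ e ∣² ≈ 1.
record GainFunction {n} (G : Graph n) : Set where
  open Graph G using (Adj)
  field
    φ         : ∀ {i j} → Adj i j → ℂ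
    φ-unit    : ∀ {i j} (e : Adj i j) → ∣ φ e ∣² ≈ℝ 1ℝ
    φ-inverse : ∀ {i j} (e : Adj i j) (e′ : Adj j i) → φ e * φ e′ ≈ 1ℂ
    φ-conj    : ∀ {i j} (e : Adj i j) (e′ : Adj j i) → φ e′ ≈ conj (φ e)

record GainGraph (n : ℕ) : Set where
  field
    graph : Graph n
    gain  : GainFunction graph
  open Graph graph public
  open GainFunction gain public

onEdge : ∀ {P : Set} → Dec P → (P → ℂ) → ℂ
onEdge (yes e) f = f e
onEdge (no _)  f = 0ℂ

adjacencyMatrix : ∀ {n} → Graph n → Matrix n n
adjacencyMatrix G i j = onEdge (Graph.adj? G i j) λ _ → 1ℂ

gainMatrix : ∀ {n} → GainGraph n → Matrix n n
gainMatrix Φ i j = onEdge (GainGraph.adj? Φ i j) (GainGraph.φ Φ)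

{-# OPTIONS --safe #-}
-- Multiplying the gains by a suitable potential makes them equal to 1 along a
-- spanning forest, so after this switching A(Φ) and A(G) agree outside the
-- columns indexed by the endpoints of the θ(G) remaining edges.  Hence a family
-- of independent columns of one matrix, once those at most 2θ(G) columns are
-- dropped from it, is also independent in the other.
module Submission where

open import Defs
open import Algebra.Bundles using (CommutativeSemiring)
open import Algebra.Structures using (IsCommutativeMonoid; IsCommutativeSemiring)
import Algebra.Structures.Biased as Biased
import Algebra.Properties.Semiring.Sum as SemiringSum
import Algebra.Solver.CommutativeMonoid as CommutativeMonoidSolver
open import Data.Bool using (if_then_else_)
open import Data.Empty using (⊥-elim)
open import Data.Fin using (Fin; punchIn; punchOut)
import Data.Fin as Fin
import Data.Fin.Properties as Fin
open import Data.Integer using (+_; _≤_) renaming (_+_ to _+ℤ_; _-_ to _-ℤ_; _*_ to _*ℤ_)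
import Data.Integer as ℤ
import Data.Integer.Properties as ℤ
import Data.Integer.Solver as ℤ-Solver
open import Data.List using (List; []; _∷_; length; cartesianProduct; allFin)
open import Data.List.Membership.Propositional using (_∈_; _∉_)
open import Data.List.Membership.Propositional.Properties using (∈-filter⁺; ∈-filter⁻; ∈-cartesianProduct⁺; ∈-allFin)
open import Data.List.Relation.Unary.Any using (here; there)
open import Data.Nat using (ℕ; zero; suc)
import Data.Nat as ℕ
import Data.Nat.Properties as ℕ
import Data.Nat.Solver as ℕ-Solver
open import Data.Product using (∃; _×_; _,_; proj₁; proj₂)
import Data.Product as Product
open import Data.Rational using (ℚ; 0ℚ; 1ℚ; ½)
import Data.Rational as ℚ
import Data.Rational.Properties as ℚ
import Data.Rational.Solver as ℚ-Solver
open import Data.Sum using (_⊎_; inj₁; inj₂)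
import Data.Sum as Sum
open import Data.Vec.Functional using (insertAt)
open import Data.Vec.Functional.Properties using (insertAt-lookup; insertAt-punchIn)
open import Function using (_∘_; id)
open import Function.Definitions using (Injective; StrictlySurjective)
open import Level using (0ℓ)
open import Relation.Binary using (IsEquivalence; Tri; tri<; tri≈; tri>)
open import Relation.Binary.Construct.Closure.ReflexiveTransitive using (ε; _◅_)
open import Relation.Binary.PropositionalEquality
import Relation.Binary.Reasoning.Setoid as SetoidReasoning
open import Relation.Nullary using (yes; no; does; contradiction; _×-dec_)
open GainGraph using (graph)

-- The commutative semiring of complex numbers

-- The field `close` of `x ≈ℝ y` is exactly this property of the difference sequence, so the laws of
-- `_≈ℝ_` reduce to closure properties of null sequences.
Null : (ℕ → ℚ) → Set
Null x = ∀ δ → 0ℚ ℚ.< δ → ∃ λ N → ∀ n → N ℕ.≤ n → ℚ.∣ x n ∣ ℚ.< δ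

module _ where
  open ℚ-Solver.+-*-Solver

  Null-cong : ∀ {x y} → x ≗ y → Null x → Null y
  Null-cong x≗y nx δ 0<δ =
    Product.map₂ (λ h n p → subst (λ q → ℚ.∣ q ∣ ℚ.< δ) (x≗y n) (h n p)) (nx δ 0<δ)

  Null-neg : ∀ {x} → Null x → Null (ℚ.-_ ∘ x)
  Null-neg {x} nx δ 0<δ =
    Product.map₂ (λ h n p → subst (ℚ._< δ) (sym (ℚ.∣-p∣≡∣p∣ (x n))) (h n p)) (nx δ 0<δ)

  Null-+ : ∀ {x y} → Null x → Null y → Null (λ n → x n ℚ.+ y n)
  Null-+ {x} {y} nx ny δ 0<δ with nx (½ ℚ.* δ) 0<δ/2 | ny (½ ℚ.* δ) 0<δ/2
    where
    0<δ/2 : 0ℚ ℚ.< ½ ℚ.* δ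
    0<δ/2 = subst (ℚ._< ½ ℚ.* δ) (ℚ.*-zeroʳ ½) (ℚ.*-monoʳ-<-pos ½ 0<δ)
  ... | M , hx | N , hy = M ℕ.⊔ N , λ n p → begin-strict
    ℚ.∣ x n ℚ.+ y n ∣          ≤⟨ ℚ.∣p+q∣≤∣p∣+∣q∣ (x n) (y n) ⟩
    ℚ.∣ x n ∣ ℚ.+ ℚ.∣ y n ∣    <⟨ ℚ.+-mono-< (hx n (ℕ.m⊔n≤o⇒m≤o M N p)) (hy n (ℕ.m⊔n≤o⇒n≤o M N p)) ⟩
    ½ ℚ.* δ ℚ.+ ½ ℚ.* δ        ≡⟨ ℚ.*-distribʳ-+ δ ½ ½ ⟨
    1ℚ ℚ.* δ                   ≡⟨ ℚ.*-identityˡ δ ⟩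
    δ ∎
    where open ℚ.≤-Reasoning

  -- A Cauchy sequence is eventually bounded by some `B`, so it is enough to push `y` below `δ`
  -- divided by `B`. Here `B` is 1 plus the absolute value of a term after which `x` varies by less
  -- than 1.
  Null-*ˡ : ∀ x {y} → Null y → Null (λ n → seq x n ℚ.* y n)
  Null-*ˡ (mkℝ x cx) {y} ny δ 0<δ with cx 1ℚ (ℚ.positive⁻¹ 1ℚ)
  ... | M , hx = M ℕ.⊔ N , λ n p → begin-strict
    ℚ.∣ x n ℚ.* y n ∣          ≡⟨ ℚ.∣p*q∣≡∣p∣*∣q∣ (x n) (y n) ⟩
    ℚ.∣ x n ∣ ℚ.* ℚ.∣ y n ∣    ≤⟨ ℚ.*-monoʳ-≤-nonNeg ℚ.∣ y n ∣ {{ℚ.∣-∣-nonNeg (y n)}}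
                                    (bound n (ℕ.m⊔n≤o⇒m≤o M N p)) ⟩
    B ℚ.* ℚ.∣ y n ∣            <⟨ ℚ.*-monoʳ-<-pos B (proj₂ small n (ℕ.m⊔n≤o⇒n≤o M N p)) ⟩
    B ℚ.* (ℚ.1/ B ℚ.* δ)       ≡⟨ ℚ.*-assoc B (ℚ.1/ B) δ ⟨
    (B ℚ.* ℚ.1/ B) ℚ.* δ       ≡⟨ cong (ℚ._* δ) (ℚ.*-inverseʳ B) ⟩
    1ℚ ℚ.* δ                   ≡⟨ ℚ.*-identityˡ δ ⟩
    δ ∎
    where
    open ℚ.≤-Reasoning
    B : ℚ
    B = 1ℚ ℚ.+ ℚ.∣ x M ∣
    instance
      B⁺ : ℚ.Positive B
      B⁺ = ℚ.positive (ℚ.+-mono-<-≤ (ℚ.positive⁻¹ 1ℚ) (ℚ.0≤∣p∣ (x M)))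
      B≢0 : ℚ.NonZero B
      B≢0 = ℚ.pos⇒nonZero B
    bound : ∀ n → M ℕ.≤ n → ℚ.∣ x n ∣ ℚ.≤ B
    bound n p = begin
      ℚ.∣ x n ∣                            ≡⟨ cong ℚ.∣_∣ (solve 2 (λ a b → a := (a :- b) :+ b) refl (x n) (x M)) ⟩
      ℚ.∣ (x n ℚ.- x M) ℚ.+ x M ∣          ≤⟨ ℚ.∣p+q∣≤∣p∣+∣q∣ (x n ℚ.- x M) (x M) ⟩
      ℚ.∣ x n ℚ.- x M ∣ ℚ.+ ℚ.∣ x M ∣      ≤⟨ ℚ.+-monoˡ-≤ ℚ.∣ x M ∣ (ℚ.<⇒≤ (hx n M p ℕ.≤-refl)) ⟩
      B ∎
    small : ∃ λ N → ∀ n → N ℕ.≤ n → ℚ.∣ y n ∣ ℚ.< ℚ.1/ B ℚ.* δ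
    small = ny (ℚ.1/ B ℚ.* δ)
      (subst (ℚ._< ℚ.1/ B ℚ.* δ) (ℚ.*-zeroʳ (ℚ.1/ B)) (ℚ.*-monoʳ-<-pos (ℚ.1/ B) {{ℚ.1/pos⇒pos B}} 0<δ))
    N : ℕ
    N = proj₁ small

  -- The operations on reals act termwise, so this turns each algebraic law into an identity between
  -- rationals.
  ≗⇒≈ℝ : ∀ {x y} → seq x ≗ seq y → x ≈ℝ y
  ≗⇒≈ℝ {x} {y} x≗y = mk≈ℝ λ δ 0<δ → 0 , λ n _ → subst (λ q → ℚ.∣ q ∣ ℚ.< δ)
    (sym (trans (cong (ℚ._- seq y n) (x≗y n)) (ℚ.+-inverseʳ (seq y n)))) 0<δ

  ≈ℝ-sym : ∀ {x y} → x ≈ℝ y → y ≈ℝ x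
  ≈ℝ-sym {x} {y} (mk≈ℝ h) = mk≈ℝ (Null-cong
    (λ n → solve 2 (λ a b → :- (a :- b) := b :- a) refl (seq x n) (seq y n)) (Null-neg h))

  ≈ℝ-trans : ∀ {x y z} → x ≈ℝ y → y ≈ℝ z → x ≈ℝ z
  ≈ℝ-trans {x} {y} {z} (mk≈ℝ h) (mk≈ℝ k) = mk≈ℝ (Null-cong
    (λ n → solve 3 (λ a b c → (a :- b) :+ (b :- c) := a :- c) refl (seq x n) (seq y n) (seq z n))
    (Null-+ h k))

  +ℝ-cong : ∀ {x y u v} → x ≈ℝ y → u ≈ℝ v → x +ℝ u ≈ℝ y +ℝ v
  +ℝ-cong {x} {y} {u} {v} (mk≈ℝ h) (mk≈ℝ k) = mk≈ℝ (Null-cong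
    (λ n → solve 4 (λ a b c d → (a :- b) :+ (c :- d) := (a :+ c) :- (b :+ d)) refl
                      (seq x n) (seq y n) (seq u n) (seq v n))
    (Null-+ h k))

  -ℝ-cong : ∀ {x y} → x ≈ℝ y → -ℝ x ≈ℝ -ℝ y
  -ℝ-cong {x} {y} (mk≈ℝ h) = mk≈ℝ (Null-cong
    (λ n → solve 2 (λ a b → :- (a :- b) := (:- a) :- (:- b)) refl (seq x n) (seq y n)) (Null-neg h))

  *ℝ-cong : ∀ {x y u v} → x ≈ℝ y → u ≈ℝ v → x *ℝ u ≈ℝ y *ℝ v
  *ℝ-cong {x} {y} {u} {v} (mk≈ℝ h) (mk≈ℝ k) = mk≈ℝ (Null-cong
    -- The difference of products is split into two terms, each a real times a null sequence.
    (λ n → solve 4 (λ a b c d → a :* (c :- d) :+ d :* (a :- b) := a :* c :- b :* d) refl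
                      (seq x n) (seq y n) (seq u n) (seq v n))
    (Null-+ (Null-*ˡ x k) (Null-*ˡ v h)))

  ≈-isEquivalence : IsEquivalence _≈_
  ≈-isEquivalence = record
    { refl  = mk≈ (≗⇒≈ℝ λ _ → refl) (≗⇒≈ℝ λ _ → refl)
    ; sym   = λ (mk≈ p q) → mk≈ (≈ℝ-sym p) (≈ℝ-sym q)
    ; trans = λ (mk≈ p q) (mk≈ r s) → mk≈ (≈ℝ-trans p r) (≈ℝ-trans q s)
    }

  +-cong : ∀ {x y u v} → x ≈ y → u ≈ v → x + u ≈ y + v
  +-cong (mk≈ p q) (mk≈ r s) = mk≈ (+ℝ-cong p r) (+ℝ-cong q s)

  *-cong : ∀ {x y u v} → x ≈ y → u ≈ v → x * u ≈ y * v
  *-cong (mk≈ p q) (mk≈ r s) =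
    mk≈ (+ℝ-cong (*ℝ-cong p r) (-ℝ-cong (*ℝ-cong q s))) (+ℝ-cong (*ℝ-cong p s) (*ℝ-cong q r))

  +-isCommutativeMonoid : IsCommutativeMonoid _≈_ _+_ 0ℂ
  +-isCommutativeMonoid = Biased.isCommutativeMonoidˡ record
    { isSemigroup = record
      { isMagma = record { isEquivalence = ≈-isEquivalence ; ∙-cong = +-cong }
      ; assoc   = λ x y z → mk≈
          (≗⇒≈ℝ λ n → ℚ.+-assoc (seq (re x) n) (seq (re y) n) (seq (re z) n))
          (≗⇒≈ℝ λ n → ℚ.+-assoc (seq (im x) n) (seq (im y) n) (seq (im z) n))
      }
    ; identityˡ = λ x → mk≈ (≗⇒≈ℝ λ n → ℚ.+-identityˡ (seq (re x) n))
                            (≗⇒≈ℝ λ n → ℚ.+-identityˡ (seq (im x) n))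
    ; comm      = λ x y → mk≈ (≗⇒≈ℝ λ n → ℚ.+-comm (seq (re x) n) (seq (re y) n))
                              (≗⇒≈ℝ λ n → ℚ.+-comm (seq (im x) n) (seq (im y) n))
    }

  *-isCommutativeMonoid : IsCommutativeMonoid _≈_ _*_ 1ℂ
  *-isCommutativeMonoid = Biased.isCommutativeMonoidˡ record
    { isSemigroup = record
      { isMagma = record { isEquivalence = ≈-isEquivalence ; ∙-cong = *-cong }
      ; assoc   = λ x y z → mk≈
          (≗⇒≈ℝ λ n → solve 6 (λ a a′ b b′ c c′ →
              (a :* b :- a′ :* b′) :* c :- (a :* b′ :+ a′ :* b) :* c′
              := a :* (b :* c :- b′ :* c′) :- a′ :* (b :* c′ :+ b′ :* c)) refl
            (seq (re x) n) (seq (im x) n) (seq (re y) n) (seq (im y) n) (seq (re z) n) (seq (im z) n))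
          (≗⇒≈ℝ λ n → solve 6 (λ a a′ b b′ c c′ →
              (a :* b :- a′ :* b′) :* c′ :+ (a :* b′ :+ a′ :* b) :* c
              := a :* (b :* c′ :+ b′ :* c) :+ a′ :* (b :* c :- b′ :* c′)) refl
            (seq (re x) n) (seq (im x) n) (seq (re y) n) (seq (im y) n) (seq (re z) n) (seq (im z) n))
      }
    ; identityˡ = λ x → mk≈
        (≗⇒≈ℝ λ n → solve 2 (λ a a′ → con 1ℚ :* a :- con 0ℚ :* a′ := a) refl
          (seq (re x) n) (seq (im x) n))
        (≗⇒≈ℝ λ n → solve 2 (λ a a′ → con 1ℚ :* a′ :+ con 0ℚ :* a := a′) refl
          (seq (re x) n) (seq (im x) n))
    ; comm      = λ x y → mk≈
        (≗⇒≈ℝ λ n → solve 4 (λ a a′ b b′ → a :* b :- a′ :* b′ := b :* a :- b′ :* a′) refl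
          (seq (re x) n) (seq (im x) n) (seq (re y) n) (seq (im y) n))
        (≗⇒≈ℝ λ n → solve 4 (λ a a′ b b′ → a :* b′ :+ a′ :* b := b :* a′ :+ b′ :* a) refl
          (seq (re x) n) (seq (im x) n) (seq (re y) n) (seq (im y) n))
    }

  isCommutativeSemiring : IsCommutativeSemiring _≈_ _+_ _*_ 0ℂ 1ℂ
  isCommutativeSemiring = Biased.isCommutativeSemiringˡ record
    { +-isCommutativeMonoid = +-isCommutativeMonoid
    ; *-isCommutativeMonoid = *-isCommutativeMonoid
    ; distribʳ = λ z x y → mk≈
        (≗⇒≈ℝ λ n → solve 6 (λ a a′ b b′ c c′ →
            (a :+ b) :* c :- (a′ :+ b′) :* c′
            := (a :* c :- a′ :* c′) :+ (b :* c :- b′ :* c′)) refl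
          (seq (re x) n) (seq (im x) n) (seq (re y) n) (seq (im y) n) (seq (re z) n) (seq (im z) n))
        (≗⇒≈ℝ λ n → solve 6 (λ a a′ b b′ c c′ →
            (a :+ b) :* c′ :+ (a′ :+ b′) :* c
            := (a :* c′ :+ a′ :* c) :+ (b :* c′ :+ b′ :* c)) refl
          (seq (re x) n) (seq (im x) n) (seq (re y) n) (seq (im y) n) (seq (re z) n) (seq (im z) n))
    ; zeroˡ = λ x → mk≈
        (≗⇒≈ℝ λ n → solve 2 (λ a a′ → con 0ℚ :* a :- con 0ℚ :* a′ := con 0ℚ) refl
          (seq (re x) n) (seq (im x) n))
        (≗⇒≈ℝ λ n → solve 2 (λ a a′ → con 0ℚ :* a′ :+ con 0ℚ :* a := con 0ℚ) refl
          (seq (re x) n) (seq (im x) n))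
    }

ℂ-commutativeSemiring : CommutativeSemiring 0ℓ 0ℓ
ℂ-commutativeSemiring = record { isCommutativeSemiring = isCommutativeSemiring }

private
  module C = CommutativeSemiring ℂ-commutativeSemiring
  module *S = CommutativeMonoidSolver C.*-commutativeMonoid
open *S using (_⊕_; _⊜_)
open SemiringSum C.semiring using (sum-cong-≋; sum-remove; *-distribʳ-sum)

-- Multiplication by the explicit inverse `v` replaces a test of whether `u` is nonzero, which is
-- undecidable.
cancel-unitʳ : ∀ {x u v} → u * v ≈ 1ℂ → x * u ≈ 0ℂ → x ≈ 0ℂ
cancel-unitʳ {x} {u} {v} uv≈1 xu≈0 = begin
  x            ≈⟨ C.*-identityʳ x ⟨
  x * 1ℂ       ≈⟨ *-cong C.refl uv≈1 ⟨
  x * (u * v)  ≈⟨ C.*-assoc x u v ⟨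
  x * u * v    ≈⟨ *-cong xu≈0 C.refl ⟩
  0ℂ * v       ≈⟨ C.zeroˡ v ⟩
  0ℂ ∎
  where open SetoidReasoning C.setoid

-- Selections of independent columns

-- A relation among the remaining vectors extends to the whole family with coefficient 0 at `p`.
LinearlyIndependent-remove : ∀ {m k} (v : Fin (suc k) → Fin m → ℂ) →
  LinearlyIndependent v → ∀ p → LinearlyIndependent (v ∘ punchIn p)
LinearlyIndependent-remove {k = k} v ind p c h j =
  subst (_≈ 0ℂ) (insertAt-punchIn c p 0ℂ j) (ind c′ vanishes (punchIn p j))
  where
  open SetoidReasoning C.setoid
  c′ : Fin (suc k) → ℂ
  c′ = insertAt c p 0ℂ
  vanishes : ∀ i → ∑ (λ j → c′ j * v j i) ≈ 0ℂ
  vanishes i = begin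
    ∑ (λ j → c′ j * v j i)
      ≈⟨ sum-remove {i = p} (λ j → c′ j * v j i) ⟩
    c′ p * v p i + ∑ (λ j → c′ (punchIn p j) * v (punchIn p j) i)
      ≈⟨ +-cong (*-cong (C.reflexive (insertAt-lookup c p 0ℂ)) C.refl)
                (sum-cong-≋ λ j → *-cong (C.reflexive (insertAt-punchIn c p 0ℂ j)) C.refl) ⟩
    0ℂ * v p i + ∑ (λ j → c j * v (punchIn p j) i)
      ≈⟨ +-cong (C.zeroˡ (v p i)) (h i) ⟩
    0ℂ + 0ℂ
      ≈⟨ C.+-identityˡ 0ℂ ⟩
    0ℂ ∎

record IndependentColumnsAvoiding {m n} (A : Matrix m n) (S : List (Fin n)) (k : ℕ) : Set where
  field
    columns     : Fin k → Fin n
    injective   : Injective _≡_ _≡_ columns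
    independent : LinearlyIndependent (λ j i → A i (columns j))
    avoids      : ∀ j → columns j ∉ S

-- The selected columns are distinct, so each entry of `S` rules out at most one of them.
-- Repetitions in `S` only weaken the bound.
avoid : ∀ {m n k} {A : Matrix m n} (S : List (Fin n)) → HasIndependentColumns A k →
        ∃ λ k′ → k ℕ.≤ k′ ℕ.+ length S × IndependentColumnsAvoiding A S k′
avoid {k = k} [] (s , inj , ind) = k , ℕ.m≤m+n k 0 , record
  { columns = s ; injective = inj ; independent = ind ; avoids = λ _ () }
avoid {n = n} {k} {A} (x ∷ S) has with avoid {A = A} S has
... | k′ , k≤ , I = drop k′ k≤ I
  where
  drop : ∀ l → k ℕ.≤ l ℕ.+ length S → IndependentColumnsAvoiding A S l →
         ∃ λ k′ → k ℕ.≤ k′ ℕ.+ suc (length S) × IndependentColumnsAvoiding A (x ∷ S) k′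
  drop l k≤ I with Fin.any? (λ j → IndependentColumnsAvoiding.columns I j Fin.≟ x)
  ... | no none = l , ℕ.≤-trans k≤ (ℕ.+-monoʳ-≤ l (ℕ.n≤1+n _)) , record
    { columns     = columns
    ; injective   = injective
    ; independent = independent
    ; avoids      = λ { j (here eq) → none (j , eq) ; j (there q) → avoids j q }
    }
    where open IndependentColumnsAvoiding I
  -- The position `p` makes the count a successor; the one column lost is paid for by the entry `x`.
  drop (suc l) k≤ I | yes (p , sp≡x) = l , ℕ.≤-trans k≤ (ℕ.≤-reflexive (sym (ℕ.+-suc l _))) , record
    { columns     = columns ∘ punchIn p
    ; injective   = λ {i} {j} → Fin.punchIn-injective p i j ∘ injective
    ; independent = LinearlyIndependent-remove (λ j i → A i (columns j)) independent p
    ; avoids      = λ { j (here eq) → Fin.punchInᵢ≢i p j (injective (trans eq (sym sp≡x)))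
                      ; j (there q) → avoids (punchIn p j) q }
    }
    where open IndependentColumnsAvoiding I

-- With D the diagonal matrix of `d`, the hypothesis says that AD and DB have the same columns
-- outside `S`. A relation among columns of B, with each coefficient multiplied by the `d` of its
-- column, is therefore a relation among columns of A, and the invertible factors then cancel.
independent-switch : ∀ {n k} {A B : Matrix n n} {S : List (Fin n)} (d d⁻¹ : Fin n → ℂ) →
  (∀ i → d i * d⁻¹ i ≈ 1ℂ) → (∀ i j → j ∉ S → A i j * d j ≈ B i j * d i) →
  IndependentColumnsAvoiding A S k → HasIndependentColumns B k
independent-switch {A = A} {B} d d⁻¹ unit AB I =
  columns , injective , λ c h j → cancel-unitʳ (unit (columns j))
    (independent (λ j → c j * d (columns j)) (λ i → begin
      ∑ (λ j → c j * d (columns j) * A i (columns j))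
        ≈⟨ sum-cong-≋ (λ j → begin
             c j * d (columns j) * A i (columns j)
               ≈⟨ *S.solve 3 (λ x y z → (x ⊕ y) ⊕ z ⊜ x ⊕ (z ⊕ y)) C.refl (c j) (d (columns j)) (A i (columns j)) ⟩
             c j * (A i (columns j) * d (columns j))
               ≈⟨ *-cong C.refl (AB i (columns j) (avoids j)) ⟩
             c j * (B i (columns j) * d i)
               ≈⟨ C.*-assoc (c j) (B i (columns j)) (d i) ⟨
             c j * B i (columns j) * d i ∎) ⟩
      ∑ (λ j → c j * B i (columns j) * d i)
        ≈⟨ *-distribʳ-sum (d i) (λ j → c j * B i (columns j)) ⟨
      ∑ (λ j → c j * B i (columns j)) * d i
        ≈⟨ *-cong (h i) C.refl ⟩
      0ℂ * d i
        ≈⟨ C.zeroˡ (d i) ⟩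
      0ℂ ∎) j)
  where
  open IndependentColumnsAvoiding I
  open SetoidReasoning C.setoid

rank-switch : ∀ {n r s} {A B : Matrix n n} (S : List (Fin n)) (d d⁻¹ : Fin n → ℂ) →
  (∀ i → d i * d⁻¹ i ≈ 1ℂ) → (∀ i j → j ∉ S → A i j * d j ≈ B i j * d i) →
  IsRank A r → IsRank B s → r ℕ.≤ s ℕ.+ length S
rank-switch {A = A} {B} S d d⁻¹ unit AB rA rB with avoid {A = A} S (attained rA)
... | k , r≤ , I = ℕ.≤-trans r≤ (ℕ.+-monoˡ-≤ (length S)
  (maximal rB k (independent-switch {A = A} {B} d d⁻¹ unit AB I)))

-- Potentials along a spanning forest

-- The quotient map gluing `y` to `x`: the label `y` is deleted, the labels above it move down, and
-- `y` itself goes where `x` goes.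
merge : ∀ {c} {x y : Fin (suc c)} → y ≢ x → Fin (suc c) → Fin c
merge {y = y} y≢x z with y Fin.≟ z
... | yes _  = punchOut y≢x
... | no y≢z = punchOut y≢z

merge-≡ : ∀ {c} {x y : Fin (suc c)} (y≢x : y ≢ x) → merge y≢x x ≡ merge y≢x y
merge-≡ {x = x} {y} y≢x with y Fin.≟ x | y Fin.≟ y
... | yes y≡x | _       = contradiction y≡x y≢x
... | no _    | yes _   = Fin.punchOut-cong y refl
... | no _    | no y≢y  = contradiction refl y≢y

merge-punchIn : ∀ {c} {x y : Fin (suc c)} (y≢x : y ≢ x) k → merge y≢x (punchIn y k) ≡ k
merge-punchIn {y = y} y≢x k with y Fin.≟ punchIn y k
... | yes eq = contradiction (sym eq) (Fin.punchInᵢ≢i y k)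
... | no _   = trans (Fin.punchOut-cong y refl) (Fin.punchOut-punchIn y)

-- A multiplier that is constant on components: it rescales the component labelled `y` and fixes all
-- others.
spike : ∀ {c} → Fin c → ℂ → Fin c → ℂ
spike y f k = if does (k Fin.≟ y) then f else 1ℂ

spike-≡ : ∀ {c} (y : Fin c) f → spike y f y ≡ f
spike-≡ y f with y Fin.≟ y
... | yes _  = refl
... | no y≢y = contradiction refl y≢y

spike-≢ : ∀ {c} {y k : Fin c} f → k ≢ y → spike y f k ≡ 1ℂ
spike-≢ {y = y} {k} f k≢y with k Fin.≟ y
... | yes k≡y = contradiction k≡y k≢y
... | no _    = refl

spike-unit : ∀ {c} (y : Fin c) {f g} → f * g ≈ 1ℂ → ∀ k → spike y f k * spike y g k ≈ 1ℂ
spike-unit y fg≈1 k with k Fin.≟ y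
... | yes _ = fg≈1
... | no _  = C.*-identityˡ 1ℂ

-- The c labels are the components of the graph with edges es, and bad lists
-- both endpoints of each edge that closed a cycle when it was added.
record Potential {n} (w : Matrix n n) (es : List (Fin n × Fin n)) (c : ℕ) : Set where
  field
    label      : Fin n → Fin c
    label-onto : StrictlySurjective _≡_ label
    label-edge : ∀ {i j} → (i , j) ∈ es → label i ≡ label j
    d d⁻¹      : Fin n → ℂ
    d-unit     : ∀ i → d i * d⁻¹ i ≈ 1ℂ
    bad        : List (Fin n)
    bad-count  : length bad ℕ.+ 2 ℕ.* n ≡ 2 ℕ.* length es ℕ.+ 2 ℕ.* c
    switched   : ∀ {i j} → (i , j) ∈ es → (i ∈ bad × j ∈ bad) ⊎ (w i j * d j ≈ d i)

module _ {n} {w : Matrix n n} where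

  -- Here `z` is the inverse gain. An edge inside one component closes a cycle: `bad` grows by two
  -- and the component count stays. An edge between two components merges them: `bad` stays and the
  -- count drops by one. Either way `length bad` remains 2(|es| - n + c), which `bad-count` states
  -- without subtraction.
  addEdge : ∀ {a b es c} z → w a b * z ≈ 1ℂ → Potential w es c → ∃ (Potential w ((a , b) ∷ es))
  addEdge {a} {c = zero} z _ P = ⊥-elim (Fin.¬Fin0 (Potential.label P a))
  addEdge {a} {b} {es} {suc c} z wz≈1 P with Potential.label P b Fin.≟ Potential.label P a
  ... | yes b≡a = suc c , record
    { label      = label
    ; label-onto = label-onto
    ; label-edge = λ { (here refl) → sym b≡a ; (there e) → label-edge e }
    ; d          = d
    ; d⁻¹        = d⁻¹
    ; d-unit     = d-unit
    -- Both endpoints are listed because the edge has an entry in column `b` and, reversed, one in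
    -- column `a`.
    ; bad        = a ∷ b ∷ bad
    ; bad-count  = trans (cong (2 ℕ.+_) bad-count)
        (solve 2 (λ e c → con 2 :+ (con 2 :* e :+ con 2 :* c) := con 2 :* (con 1 :+ e) :+ con 2 :* c)
          refl (length es) (suc c))
    ; switched   = λ { (here refl) → inj₁ (here refl , there (here refl))
                     ; (there e)   → Sum.map₁ (Product.map (there ∘ there) (there ∘ there)) (switched e) }
    }
    where
    open Potential P
    open ℕ-Solver.+-*-Solver
  ... | no b≢a = c , record
    { label      = merge b≢a ∘ label
    ; label-onto = λ k → let i , eq = label-onto (punchIn (label b) k) in
        i , trans (cong (merge b≢a) eq) (merge-punchIn b≢a k)
    ; label-edge = λ { (here refl) → merge-≡ b≢a ; (there e) → cong (merge b≢a) (label-edge e) }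
    -- Only the old component of `b` is rescaled, so that the new edge gets switched gain 1.
    ; d          = λ i → d i * s (label i)
    ; d⁻¹        = λ i → d⁻¹ i * s⁻¹ (label i)
    ; d-unit     = λ i → begin
        d i * s (label i) * (d⁻¹ i * s⁻¹ (label i))
          ≈⟨ *S.solve 4 (λ x y u v → (x ⊕ y) ⊕ (u ⊕ v) ⊜ (x ⊕ u) ⊕ (y ⊕ v)) C.refl
                        (d i) (s (label i)) (d⁻¹ i) (s⁻¹ (label i)) ⟩
        d i * d⁻¹ i * (s (label i) * s⁻¹ (label i))
          ≈⟨ *-cong (d-unit i) (spike-unit (label b) f-unit (label i)) ⟩
        1ℂ * 1ℂ
          ≈⟨ C.*-identityˡ 1ℂ ⟩
        1ℂ ∎
    ; bad        = bad
    ; bad-count  = trans bad-count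
        (solve 2 (λ e c → con 2 :* e :+ con 2 :* (con 1 :+ c) := con 2 :* (con 1 :+ e) :+ con 2 :* c)
          refl (length es) c)
    ; switched   = λ { (here refl) → inj₂ new ; (there e) → Sum.map₂ (old e) (switched e) }
    }
    where
    open Potential P
    open ℕ-Solver.+-*-Solver
    open SetoidReasoning C.setoid

    f f⁻¹ : ℂ
    -- The solution of `w a b * (d b * f) ≈ d a`.
    f   = d a * d⁻¹ b * z
    f⁻¹ = w a b * d b * d⁻¹ a

    f-unit : f * f⁻¹ ≈ 1ℂ
    f-unit = begin
      d a * d⁻¹ b * z * (w a b * d b * d⁻¹ a)
        ≈⟨ *S.solve 6 (λ a a′ b b′ z w → ((a ⊕ b′) ⊕ z) ⊕ ((w ⊕ b) ⊕ a′) ⊜ (a ⊕ a′) ⊕ ((b ⊕ b′) ⊕ (w ⊕ z)))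
                      C.refl (d a) (d⁻¹ a) (d b) (d⁻¹ b) z (w a b) ⟩
      d a * d⁻¹ a * (d b * d⁻¹ b * (w a b * z))
        ≈⟨ *-cong (d-unit a) (*-cong (d-unit b) wz≈1) ⟩
      1ℂ * (1ℂ * 1ℂ)
        ≈⟨ C.trans (C.*-identityˡ _) (C.*-identityˡ _) ⟩
      1ℂ ∎

    s s⁻¹ : Fin (suc c) → ℂ
    s   = spike (label b) f
    s⁻¹ = spike (label b) f⁻¹

    new : w a b * (d b * s (label b)) ≈ d a * s (label a)
    new = begin
      w a b * (d b * s (label b))
        ≡⟨ cong (λ q → w a b * (d b * q)) (spike-≡ (label b) f) ⟩
      w a b * (d b * (d a * d⁻¹ b * z))
        ≈⟨ *S.solve 5 (λ a b b′ z w → w ⊕ (b ⊕ ((a ⊕ b′) ⊕ z)) ⊜ a ⊕ ((b ⊕ b′) ⊕ (w ⊕ z)))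
                      C.refl (d a) (d b) (d⁻¹ b) z (w a b) ⟩
      d a * (d b * d⁻¹ b * (w a b * z))
        ≈⟨ *-cong C.refl (*-cong (d-unit b) wz≈1) ⟩
      d a * (1ℂ * 1ℂ)
        ≈⟨ *-cong C.refl (C.*-identityˡ 1ℂ) ⟩
      d a * 1ℂ
        -- The vertex `a` lies in another component, so its value is unchanged.
        ≡⟨ cong (d a *_) (spike-≢ f (b≢a ∘ sym)) ⟨
      d a * s (label a) ∎

    -- Both ends of an old edge carry the same label, hence receive the same factor.
    old : ∀ {i j} → (i , j) ∈ es → w i j * d j ≈ d i → w i j * (d j * s (label j)) ≈ d i * s (label i)
    old {i} {j} e h = begin
      w i j * (d j * s (label j))  ≈⟨ C.*-assoc (w i j) (d j) (s (label j)) ⟨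
      w i j * d j * s (label j)    ≈⟨ *-cong h (C.reflexive (cong s (sym (label-edge e)))) ⟩
      d i * s (label i) ∎

  potential : (z : Matrix n n) (es : List (Fin n × Fin n)) →
              (∀ {i j} → (i , j) ∈ es → w i j * z i j ≈ 1ℂ) → ∃ (Potential w es)
  -- Without edges every vertex is a component of its own.
  potential z [] _ = n , record
    { label      = id
    ; label-onto = λ k → k , refl
    ; label-edge = λ ()
    ; d          = λ _ → 1ℂ
    ; d⁻¹        = λ _ → 1ℂ
    ; d-unit     = λ _ → C.*-identityˡ 1ℂ
    ; bad        = []
    ; bad-count  = refl
    ; switched   = λ ()
    }
  potential z ((a , b) ∷ es) h = addEdge (z a b) (h (here refl)) (proj₂ (potential z es (h ∘ there)))

-- Gain graphs

module _ {n} (Φ : GainGraph n) where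
  open GainGraph Φ hiding (graph)

  edges-sound : ∀ {i j} → (i , j) ∈ edges → Adj i j
  edges-sound e = proj₂ (proj₂ (∈-filter⁻ (λ (i , j) → (i Fin.<? j) ×-dec adj? i j)
                                          {xs = cartesianProduct (allFin n) (allFin n)} e))

  edges-complete : ∀ {i j} → i Fin.< j → Adj i j → (i , j) ∈ edges
  edges-complete {i} {j} i<j e =
    ∈-filter⁺ (λ (i , j) → (i Fin.<? j) ×-dec adj? i j)
              (∈-cartesianProduct⁺ (∈-allFin i) (∈-allFin j)) (i<j , e)

  gainMatrix-inverse : ∀ i j → Adj i j → gainMatrix Φ i j * gainMatrix Φ j i ≈ 1ℂ
  gainMatrix-inverse i j e with adj? i j | adj? j i
  ... | yes e₁ | yes e₂ = φ-inverse e₁ e₂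
  ... | no ¬e  | _      = contradiction e ¬e
  ... | yes _  | no ¬e  = contradiction (adj-sym i j e) ¬e

  spanningPotential : ∃ (Potential (gainMatrix Φ) edges)
  spanningPotential = potential (λ i j → gainMatrix Φ j i) edges
    λ {i} {j} e → gainMatrix-inverse i j (edges-sound e)

  open Potential (proj₂ spanningPotential) public

  -- The list `edges` holds each edge with its smaller endpoint first. The opposite orientation
  -- follows on multiplying by the gain, which is inverse to the listed one.
  gain-switched : ∀ i j → Adj i j → j ∉ bad → gainMatrix Φ i j * d j ≈ d i
  gain-switched i j e j∉bad with Fin.<-cmp i j
  ... | tri≈ _ refl _ = contradiction e (adj-irrefl i)
  ... | tri< i<j _ _ with switched (edges-complete i<j e)
  ...   | inj₁ (_ , j∈bad) = contradiction j∈bad j∉bad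
  ...   | inj₂ eq          = eq
  gain-switched i j e j∉bad | tri> _ _ j<i with switched (edges-complete j<i (adj-sym i j e))
  ...   | inj₁ (j∈bad , _) = contradiction j∈bad j∉bad
  ...   | inj₂ eq          = begin
    gainMatrix Φ i j * d j                       ≈⟨ *-cong C.refl eq ⟨
    gainMatrix Φ i j * (gainMatrix Φ j i * d i)  ≈⟨ C.*-assoc _ _ _ ⟨
    gainMatrix Φ i j * gainMatrix Φ j i * d i    ≈⟨ *-cong (gainMatrix-inverse i j e) C.refl ⟩
    1ℂ * d i                                     ≈⟨ C.*-identityˡ (d i) ⟩
    d i ∎
    where open SetoidReasoning C.setoid

  matrix-switched : ∀ i j → j ∉ bad → gainMatrix Φ i j * d j ≈ adjacencyMatrix (graph Φ) i j * d i
  matrix-switched i j j∉bad with gain-switched i j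
  ... | h with adj? i j
  ...   | yes e = C.trans (h e j∉bad) (C.sym (C.*-identityˡ (d i)))
  ...   | no _  = C.trans (C.zeroˡ (d j)) (C.sym (C.zeroˡ (d i)))

  -- The previous relation multiplied by `d⁻¹ i * d⁻¹ j`: the two matrices exchange roles, and the
  -- inverse potential does the switching.
  matrix-switched⁻¹ : ∀ i j → j ∉ bad → adjacencyMatrix (graph Φ) i j * d⁻¹ j ≈ gainMatrix Φ i j * d⁻¹ i
  matrix-switched⁻¹ i j j∉bad = begin
    A * d⁻¹ j
      ≈⟨ *-cong (C.*-identityʳ A) C.refl ⟨
    A * 1ℂ * d⁻¹ j
      ≈⟨ *-cong (*-cong C.refl (d-unit i)) C.refl ⟨
    A * (d i * d⁻¹ i) * d⁻¹ j
      ≈⟨ *S.solve 4 (λ a x y u → (a ⊕ (x ⊕ y)) ⊕ u ⊜ (a ⊕ x) ⊕ (y ⊕ u)) C.refl A (d i) (d⁻¹ i) (d⁻¹ j) ⟩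
    A * d i * (d⁻¹ i * d⁻¹ j)
      ≈⟨ *-cong (matrix-switched i j j∉bad) C.refl ⟨
    B * d j * (d⁻¹ i * d⁻¹ j)
      ≈⟨ *S.solve 4 (λ b x y u → (b ⊕ x) ⊕ (y ⊕ u) ⊜ (b ⊕ y) ⊕ (x ⊕ u)) C.refl B (d j) (d⁻¹ i) (d⁻¹ j) ⟩
    B * d⁻¹ i * (d j * d⁻¹ j)
      ≈⟨ *-cong C.refl (d-unit j) ⟩
    B * d⁻¹ i * 1ℂ
      ≈⟨ C.*-identityʳ _ ⟩
    B * d⁻¹ i ∎
    where
    open SetoidReasoning C.setoid
    A B : ℂ
    A = adjacencyMatrix (graph Φ) i j
    B = gainMatrix Φ i j

  -- Counting the exceptional columns

  label-connected : ∀ {i j} → Connected i j → label i ≡ label j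
  label-connected ε = refl
  label-connected (_◅_ {i} {j} e path) = trans (step (Fin.<-cmp i j)) (label-connected path)
    where
    step : Tri (i Fin.< j) (i ≡ j) (j Fin.< i) → label i ≡ label j
    step (tri< i<j _ _) = label-edge (edges-complete i<j e)
    step (tri≈ _ i≡j _) = cong label i≡j
    step (tri> _ _ j<i) = sym (label-edge (edges-complete j<i (adj-sym i j e)))

  -- Choose a vertex for each label. Labels are constant on components, so vertices chosen for
  -- different labels lie in different components.
  labels≤ω : proj₁ spanningPotential ℕ.≤ ω (graph Φ)
  labels≤ω = Fin.injective⇒≤ {f = class ∘ proj₁ ∘ label-onto} λ {k} {l} eq → trans
    (sym (proj₂ (label-onto k))) (trans (label-connected (sound eq)) (proj₂ (label-onto l)))
    where open Classes (proj₂ (components (graph Φ)))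

  -- Over the integers `bad-count` can be solved for the length of `bad`; then the number of labels,
  -- which enters with a plus sign, is bounded by `ω`.
  ∣bad∣≤2θ : + length bad ≤ + 2 *ℤ θ (graph Φ)
  ∣bad∣≤2θ = begin
    + b
      ≡⟨ solve 2 (λ b n → b := (b :+ con (+ 2) :* n) :- con (+ 2) :* n) refl (+ b) (+ n) ⟩
    (+ b +ℤ + 2 *ℤ + n) -ℤ + 2 *ℤ + n
      ≡⟨ cong (_-ℤ + 2 *ℤ + n) count ⟩
    (+ 2 *ℤ + ∣E∣ +ℤ + 2 *ℤ + c) -ℤ + 2 *ℤ + n
      ≡⟨ solve 3 (λ m c n → (con (+ 2) :* m :+ con (+ 2) :* c) :- con (+ 2) :* n
                            := con (+ 2) :* ((m :- n) :+ c)) refl (+ ∣E∣) (+ c) (+ n) ⟩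
    + 2 *ℤ (+ ∣E∣ -ℤ + n +ℤ + c)
      ≤⟨ ℤ.*-monoˡ-≤-nonNeg (+ 2) (ℤ.+-monoʳ-≤ (+ ∣E∣ -ℤ + n) (ℤ.+≤+ labels≤ω)) ⟩
    + 2 *ℤ θ (graph Φ) ∎
    where
    open ℤ.≤-Reasoning
    open ℤ-Solver.+-*-Solver
    b c : ℕ
    b = length bad
    c = proj₁ spanningPotential
    count : + b +ℤ + 2 *ℤ + n ≡ + 2 *ℤ + ∣E∣ +ℤ + 2 *ℤ + c
    count = trans (cong (+ b +ℤ_) (sym (ℤ.pos-* 2 n)))
      (trans (cong +_ bad-count) (cong₂ _+ℤ_ (ℤ.pos-* 2 ∣E∣) (ℤ.pos-* 2 c)))

  ≤-via-bad : ∀ {r s} → r ℕ.≤ s ℕ.+ length bad → + r ≤ + s +ℤ + 2 *ℤ θ (graph Φ)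
  ≤-via-bad {s = s} r≤ = ℤ.≤-trans (ℤ.+≤+ r≤) (ℤ.+-monoʳ-≤ (+ s) ∣bad∣≤2θ)

-- The two rank inequalities

i≤j+k⇒i-k≤j : ∀ {i j} k → i ≤ j +ℤ k → i -ℤ k ≤ j
i≤j+k⇒i-k≤j {i} {j} k i≤j+k = begin
  i -ℤ k         ≤⟨ ℤ.+-monoˡ-≤ (ℤ.- k) i≤j+k ⟩
  j +ℤ k -ℤ k    ≡⟨ solve 2 (λ j k → (j :+ k) :- k := j) refl j k ⟩
  j ∎
  where
  open ℤ.≤-Reasoning
  open ℤ-Solver.+-*-Solver

theorem3p2 : (n : ℕ) (Φ : GainGraph n) (rG rΦ : ℕ) →
    IsRank (adjacencyMatrix (graph Φ)) rG →
    IsRank (gainMatrix Φ) rΦ →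
    (+ rG -ℤ + 2 *ℤ θ (graph Φ) ≤ + rΦ) × (+ rΦ ≤ + rG +ℤ + 2 *ℤ θ (graph Φ))
theorem3p2 n Φ rG rΦ isRankG isRankΦ =
  -- The lower bound switches from A(G) to A(Φ) by the inverse potential; the upper bound goes the
  -- other way by `d`.
  i≤j+k⇒i-k≤j (+ 2 *ℤ θ (graph Φ)) (≤-via-bad Φ (rank-switch (bad Φ) (d⁻¹ Φ) (d Φ)
    (λ i → C.trans (C.*-comm _ _) (d-unit Φ i)) (matrix-switched⁻¹ Φ) isRankG isRankΦ)) ,
  ≤-via-bad Φ (rank-switch (bad Φ) (d Φ) (d⁻¹ Φ) (d-unit Φ) (matrix-switched Φ) isRankΦ isRankG)
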